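{- Let $\Gamma$ be a connected finite simple graph with first Betti number $b_1\geq 2$. Let $S\leq\mathrm{Aut}(F(\Gamma))$ be the subgroup of automorphisms of $F(\Gamma)$ that fix each intersection vertex (each vertex of $F(\Gamma)\cap\mathrm{Cyc}(\Gamma)$). Then $\ker(\phi^1_\Gamma)\cong S$.
   Context: $b_1$ is the number of independent cycles. Cycle-forest decomposition: let $F_1$ be the set of leaves (degree-1 vertices) of $\Gamma$, and recursively let $F_j$ be the set of leaves of $\Gamma-\bigcup_{i<j}F_i$ (removing vertices with their incident edges), until $F_j=\emptyset$ for all $j>k$. $F(\Gamma)$ is the subgraph consisting of the vertices of $\bigcup_{i=1}^kF_i$ together with all edges of $\Gamma$ incident to them (and their endpoints); $\mathrm{Cyc}(\Gamma)=\Gamma-\bigcup_{i=1}^kF_i$; intersection vertices are those lying in both. $\Omega^1(\Gamma)$ is the space of real functions $f$ on ordered pairs $(v,w)$ of adjacent vertices with $f(v,w)=-f(w,v)$; $D$ maps a vertex function $u$ to $Du(v,w)=u(w)-u(v)$; $H^1(\Gamma)=\Omega^1(\Gamma)/\mathrm{Im}(D)$. Each $g\in\mathrm{Aut}(\Gamma)$ acts by pullback $g^*f(v,w)=f(g(v),g(w))$, descending to $H^1(\Gamma)$; $\phi^1_\Gamma(g)=(g^*)^{ -1}$.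
   Formalization: The vertex functions and 1-forms defining H¹(Γ), and hence the kernel of φ¹, take rational rather than real values; the kernel is the same over both fields by linear algebra, which is not proved here. -}

module Defs where

open import Data.Bool using (Bool; true; false; _∧_; _∨_; not; if_then_else_)
open import Data.Nat using (ℕ; zero; suc; _∸_; _<ᵇ_) renaming (_+_ to _+ℕ_)
open import Data.Fin using (Fin; toℕ)
open import Data.List using (List; map; allFin)
open import Data.Nat.ListAction using (sum)
open import Data.Bool.ListAction using (any)
open import Data.Product using (Σ; ∃; _,_; proj₁)
open import Data.Rational using (ℚ; _-_; -_)
open import Relation.Binary.PropositionalEquality using (_≡_)

record SimpleGraph (n : ℕ) : Set where
  field
    adj       : Fin n → Fin n → Bool
    adj-sym   : ∀ v w → adj v w ≡ adj w v
    adj-irrefl : ∀ v → adj v v ≡ false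
open SimpleGraph public

count : ∀ {n} → (Fin n → Bool) → ℕ
count {n} p = sum (map (λ v → if p v then 1 else 0) (allFin n))

data Reach {n} (Γ : SimpleGraph n) : Fin n → Fin n → Set where
  here : ∀ {v} → Reach Γ v v
  step : ∀ {u v w} → adj Γ u v ≡ true → Reach Γ v w → Reach Γ u w

Connected : ∀ {n} → SimpleGraph n → Set
Connected Γ = ∀ v w → Reach Γ v w

numEdges : ∀ {n} → SimpleGraph n → ℕ
numEdges {n} Γ = sum (map (λ v → count (λ w → adj Γ v w ∧ (toℕ v <ᵇ toℕ w))) (allFin n))

-- first Betti number |E| - |V| + (#components); for a connected graph c = 1
betti1Connected : ∀ {n} → SimpleGraph n → ℕ
betti1Connected {n} Γ = (numEdges Γ +ℕ 1) ∸ n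

-- Cycle–forest decomposition by iterated leaf removal.
-- removed Γ k v = true iff v ∈ F_1 ∪ … ∪ F_k.

mutual
  removed : ∀ {n} → SimpleGraph n → ℕ → Fin n → Bool
  removed Γ zero    v = false
  removed Γ (suc k) v = removed Γ k v ∨ isLeafAt Γ k v

  degAt : ∀ {n} → SimpleGraph n → ℕ → Fin n → ℕ
  degAt Γ k v = count (λ w → not (removed Γ k w) ∧ adj Γ v w)

  isLeafAt : ∀ {n} → SimpleGraph n → ℕ → Fin n → Bool
  isLeafAt Γ k v = not (removed Γ k v) ∧ isOne (degAt Γ k v)
    where
    isOne : ℕ → Bool
    isOne (suc zero) = true
    isOne _          = false

-- v ∈ ⋃ F_i  (each round removes a vertex or the process is stable,
-- so n rounds suffice)
inForestCore : ∀ {n} → SimpleGraph n → Fin n → Bool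
inForestCore {n} Γ v = removed Γ n v

inFV : ∀ {n} → SimpleGraph n → Fin n → Bool
inFV {n} Γ v = inForestCore Γ v ∨ any (λ w → inForestCore Γ w ∧ adj Γ v w) (allFin n)

inCyc : ∀ {n} → SimpleGraph n → Fin n → Bool
inCyc Γ v = not (inForestCore Γ v)

isIntersection : ∀ {n} → SimpleGraph n → Fin n → Bool
isIntersection Γ v = inFV Γ v ∧ inCyc Γ v

FVert : ∀ {n} → SimpleGraph n → Set
FVert {n} Γ = Σ (Fin n) (λ v → inFV Γ v ≡ true)

FAdj : ∀ {n} (Γ : SimpleGraph n) → FVert Γ → FVert Γ → Bool
FAdj Γ (v , _) (w , _) = adj Γ v w ∧ (inForestCore Γ v ∨ inForestCore Γ w)

record Auto (V : Set) (E : V → V → Bool) : Set where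
  field
    to      : V → V
    from    : V → V
    to-from : ∀ x → to (from x) ≡ x
    from-to : ∀ x → from (to x) ≡ x
    preserves : ∀ x y → E (to x) (to y) ≡ E x y
open Auto public

_≈ᴬ_ : ∀ {V E} → Auto V E → Auto V E → Set
g ≈ᴬ h = ∀ x → to g x ≡ to h x

_∘ᴬ_ : ∀ {V E} → Auto V E → Auto V E → Auto V E
_∘ᴬ_ {V} {E} g h = record
  { to = λ x → to g (to h x)
  ; from = λ x → from h (from g x)
  ; to-from = λ x → trans′ (cong′ (to g) (to-from h (from g x))) (to-from g x)
  ; from-to = λ x → trans′ (cong′ (from h) (from-to g (to h x))) (from-to h x)
  ; preserves = λ x y → trans′ (preserves g (to h x) (to h y)) (preserves h x y)
  }
  where
  open import Relation.Binary.PropositionalEquality using () renaming (trans to trans′; cong to cong′)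

AutΓ : ∀ {n} → SimpleGraph n → Set
AutΓ {n} Γ = Auto (Fin n) (adj Γ)

AutF : ∀ {n} → SimpleGraph n → Set
AutF Γ = Auto (FVert Γ) (FAdj Γ)

InS : ∀ {n} (Γ : SimpleGraph n) → AutF Γ → Set
InS Γ s = ∀ (x : FVert Γ) → isIntersection Γ (proj₁ x) ≡ true → proj₁ (to s x) ≡ proj₁ x

-- First cohomology H¹(Γ) = Ω¹(Γ)/Im D (rational coefficients).

-- f is a 1-form: defined on ordered adjacent pairs, antisymmetric
-- (values on non-adjacent pairs are irrelevant)
IsForm : ∀ {n} → SimpleGraph n → (Fin n → Fin n → ℚ) → Set
IsForm Γ f = ∀ v w → adj Γ v w ≡ true → f v w ≡ - f w v

IsExact : ∀ {n} → SimpleGraph n → (Fin n → Fin n → ℚ) → Set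
IsExact {n} Γ f = ∃ λ (u : Fin n → ℚ) → ∀ v w → adj Γ v w ≡ true → f v w ≡ u w - u v

pullback : ∀ {n} {Γ : SimpleGraph n} → AutΓ Γ → (Fin n → Fin n → ℚ) → Fin n → Fin n → ℚ
pullback g f v w = f (to g v) (to g w)

-- g ∈ ker φ¹_Γ : φ¹(g) = (g*)⁻¹ is the identity on H¹(Γ), i.e. g* is the
-- identity on H¹(Γ): g* f - f ∈ Im D for every 1-form f
InKer : ∀ {n} (Γ : SimpleGraph n) → AutΓ Γ → Set
InKer Γ g = ∀ f → IsForm Γ f → IsExact Γ (λ v w → pullback {Γ = Γ} g f v w - f v w)

record KerIsoS {n} (Γ : SimpleGraph n) : Set where
  field
    φ     : (g : AutΓ Γ) → InKer Γ g → AutF Γ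
    φ-S   : ∀ g k → InS Γ (φ g k)
    ψ     : (s : AutF Γ) → InS Γ s → AutΓ Γ
    ψ-ker : ∀ s p → InKer Γ (ψ s p)
    φ-resp : ∀ g g′ k k′ → g ≈ᴬ g′ → φ g k ≈ᴬ φ g′ k′
    ψ-resp : ∀ s s′ p p′ → s ≈ᴬ s′ → ψ s p ≈ᴬ ψ s′ p′
    φ-hom : ∀ g h kg kh kgh → φ (g ∘ᴬ h) kgh ≈ᴬ (φ g kg ∘ᴬ φ h kh)
    ψφ    : ∀ g k → ψ (φ g k) (φ-S g k) ≈ᴬ g
    φψ    : ∀ s p → φ (ψ s p) (ψ-ker s p) ≈ᴬ s

{-# OPTIONS --safe #-}

-- Leaf removal takes away at most as many edges as vertices, so the core Cyc(Γ) has more edges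
-- than vertices; it is connected and all its degrees are at least 2.  Let g act trivially on H¹.
-- For every edge e there is then a potential u_e with D u_e = g*e − e, where e also denotes the
-- indicator 1-form of the edge.  Summing the increment of u_e along e over all core edges e, once
-- edge by edge and once vertex by vertex, gives a Lefschetz formula without any choice of basis:
--   (fixed edges − flipped edges) − edges = fixed vertices − vertices.
-- Hence g fixes some core edge.  If M core vertices are moved, the formula allows at most M core
-- edges with a moved end; but all degrees being at least 2 there are at least M of them, and more
-- if some edge joins a fixed vertex to a moved one.  By connectedness nothing in the core moves,
-- so g is determined by its restriction to F(Γ).  Conversely, for g fixing the core pointwise the
-- form g*f − f vanishes on the core, and a potential for it extends over the leaves, which are put
-- back stage by stage.

module Submission where

open import Defs
import Algebra.Properties.Group as Group
import Algebra.Properties.Semiring.Sum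
open import Algebra.Bundles using (CommutativeRing)
open import Axiom.UniquenessOfIdentityProofs.WithK using (uip)
open import Data.Bool using (Bool; true; false; _∧_; _∨_; not; if_then_else_)
open import Data.Bool.ListAction using (any)
open import Data.Bool.Properties
  using (∧-comm; ∧-conicalˡ; ∧-conicalʳ; ∧-identityʳ; ∨-identityʳ; ∨-zeroʳ; ¬-not; ⇔→≡)
  renaming (_≟_ to _≟ᵇ_)
open import Data.Empty using (⊥; ⊥-elim)
open import Data.Fin using (Fin; zero; suc; toℕ)
open import Data.Fin.Permutation using (Permutation′; permutation)
import Data.Fin.Properties as Fin
open import Data.List using (map; tabulate)
open import Data.Nat using (ℕ; zero; suc; _≤_)
import Data.Nat as ℕ
import Data.Nat.ListAction as List
import Data.Nat.Properties
open import Data.Product using (∃; _×_; _,_; proj₁; proj₂)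
open import Data.Sum using (_⊎_; inj₁; inj₂)
open import Function using (_∘_; id)
open import Function.Bundles using (mk⇔)
open import Relation.Binary.Construct.Closure.ReflexiveTransitive using (Star; ε; _◅_)
open import Relation.Binary.PropositionalEquality hiding ([_])
open import Relation.Nullary using (Dec; yes; no; contradiction; does)

module ℕ∑ = Algebra.Properties.Semiring.Sum Data.Nat.Properties.+-*-semiring

-- Sums of natural numbers over finite index sets

module _ where
  open import Data.Nat using (_+_; _*_; _<ᵇ_; z≤n; s≤s)
  open import Data.Nat.Properties
  open import Data.Nat.Tactic.RingSolver using (solve-∀)
  open ℕ∑ using (sum; sum-cong-≗; ∑-distrib-+; ∑-comm; *-distribˡ-sum)

  𝟙 : Bool → ℕ
  𝟙 b = if b then 1 else 0

  not-false : ∀ {b} → b ≡ false → not b ≡ true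
  not-false refl = refl

  not-true⁻¹ : ∀ {b} → not b ≡ true → b ≡ false
  not-true⁻¹ {false} _ = refl

  true≢false : ∀ {b} → b ≡ true → b ≡ false → ⊥
  true≢false refl ()

  _∧-intro_ : ∀ {a b} → a ≡ true → b ≡ true → a ∧ b ≡ true
  refl ∧-intro refl = refl

  sum-mono : ∀ {n} {f g : Fin n → ℕ} → (∀ i → f i ≤ g i) → sum f ≤ sum g
  sum-mono {zero}  f≤g = z≤n
  sum-mono {suc n} f≤g = +-mono-≤ (f≤g zero) (sum-mono (f≤g ∘ suc))

  term≤sum : ∀ {n} (f : Fin n → ℕ) i → f i ≤ sum f
  term≤sum f zero    = m≤m+n (f zero) _
  term≤sum f (suc i) = ≤-trans (term≤sum (f ∘ suc) i) (m≤n+m _ (f zero))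

  terms≤sum : ∀ {n} (f : Fin n → ℕ) {i j} → i ≢ j → f i + f j ≤ sum f
  terms≤sum f {zero}  {zero}  i≢j = contradiction refl i≢j
  terms≤sum f {zero}  {suc j} i≢j = +-monoʳ-≤ (f zero) (term≤sum (f ∘ suc) j)
  terms≤sum f {suc i} {zero}  i≢j =
    subst (_≤ sum f) (+-comm (f zero) (f (suc i))) (+-monoʳ-≤ (f zero) (term≤sum (f ∘ suc) i))
  terms≤sum f {suc i} {suc j} i≢j =
    ≤-trans (terms≤sum (f ∘ suc) (i≢j ∘ cong suc)) (m≤n+m _ (f zero))

  sum-positive : ∀ {n} (f : Fin n → ℕ) → 1 ≤ sum f → ∃ λ i → 1 ≤ f i
  sum-positive {suc n} f 1≤ with f zero in eq
  ... | suc _ = zero , subst (1 ≤_) (sym eq) (s≤s z≤n)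
  ... | zero with sum-positive (f ∘ suc) 1≤
  ...   | i , 1≤fi = suc i , 1≤fi

  𝟙-positive : ∀ {b} → 1 ≤ 𝟙 b → b ≡ true
  𝟙-positive {true} _ = refl

  𝟙-true : ∀ {b} → b ≡ true → 1 ≤ 𝟙 b
  𝟙-true refl = s≤s z≤n

  𝟙≤1 : ∀ b → 𝟙 b ≤ 1
  𝟙≤1 true  = s≤s z≤n
  𝟙≤1 false = z≤n

  sum-𝟙≤ : ∀ {n} (p : Fin n → Bool) → sum (𝟙 ∘ p) ≤ n
  sum-𝟙≤ {zero}  p = z≤n
  sum-𝟙≤ {suc n} p = +-mono-≤ (𝟙≤1 (p zero)) (sum-𝟙≤ (p ∘ suc))

  listSum : ∀ {m n} (f : Fin n → ℕ) (h : Fin m → Fin n) →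
            List.sum (map f (tabulate h)) ≡ sum (f ∘ h)
  listSum {zero}  f h = refl
  listSum {suc m} f h = cong (f (h zero) +_) (listSum f (h ∘ suc))

  count≡sum : ∀ {n} (p : Fin n → Bool) → count p ≡ sum (𝟙 ∘ p)
  count≡sum p = listSum (𝟙 ∘ p) id

  count-cong : ∀ {n} {p q : Fin n → Bool} → (∀ i → p i ≡ q i) → count p ≡ count q
  count-cong {p = p} {q} p≡q =
    trans (count≡sum p) (trans (sum-cong-≗ (cong 𝟙 ∘ p≡q)) (sym (count≡sum q)))

  count≡1-unique : ∀ {n} {p : Fin n → Bool} {i j} → count p ≡ 1 → p i ≡ true → p j ≡ true → i ≡ j
  count≡1-unique {p = p} {i} {j} c pi pj with i Fin.≟ j
  ... | yes i≡j = i≡j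
  ... | no  i≢j = contradiction (begin
    2                    ≤⟨ +-mono-≤ (𝟙-true pi) (𝟙-true pj) ⟩
    𝟙 (p i) + 𝟙 (p j)    ≤⟨ terms≤sum (𝟙 ∘ p) i≢j ⟩
    sum (𝟙 ∘ p)          ≡⟨ count≡sum p ⟨
    count p              ≡⟨ c ⟩
    1                    ∎) λ { (s≤s ()) }
    where open ≤-Reasoning

  sum₂ : ∀ {m n} → (Fin m → Fin n → ℕ) → ℕ
  sum₂ f = sum λ i → sum (f i)

  sum₂-cong : ∀ {m n} {f g : Fin m → Fin n → ℕ} → (∀ i j → f i j ≡ g i j) → sum₂ f ≡ sum₂ g
  sum₂-cong f≡g = sum-cong-≗ (λ i → sum-cong-≗ (f≡g i))

  sum₂-mono : ∀ {m n} {f g : Fin m → Fin n → ℕ} → (∀ i j → f i j ≤ g i j) → sum₂ f ≤ sum₂ g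
  sum₂-mono f≤g = sum-mono (λ i → sum-mono (f≤g i))

  sum₂-+ : ∀ {m n} (f g : Fin m → Fin n → ℕ) → sum₂ (λ i j → f i j + g i j) ≡ sum₂ f + sum₂ g
  sum₂-+ f g = trans (sum-cong-≗ (λ i → ∑-distrib-+ (f i) (g i)))
                     (∑-distrib-+ (λ i → sum (f i)) (λ i → sum (g i)))

  sum₂-positive : ∀ {m n} (f : Fin m → Fin n → ℕ) → 1 ≤ sum₂ f → ∃ λ i → ∃ λ j → 1 ≤ f i j
  sum₂-positive f 1≤ with sum-positive _ 1≤
  ... | i , 1≤fi with sum-positive _ 1≤fi
  ...   | j , 1≤fij = i , j , 1≤fij

  term≤sum₂ : ∀ {m n} (f : Fin m → Fin n → ℕ) i j → f i j ≤ sum₂ f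
  term≤sum₂ f i j = ≤-trans (term≤sum (f i) j) (term≤sum (λ i → sum (f i)) i)

  -- The stages of leaf removal

  module _ {n : ℕ} (Γ : SimpleGraph n) where

    alive : ℕ → Fin n → Bool
    alive k v = not (removed Γ k v)

    -- Adjacency in the graph left after `k` rounds. At `k = n` this graph is Cyc(Γ), since
    -- `inCyc Γ` is `alive n` by definition.
    adjAt : ℕ → Fin n → Fin n → Bool
    adjAt k v w = (alive k v ∧ alive k w) ∧ adj Γ v w

    private
      -- The test `isOne` is local to `isLeafAt`, so the degree is read off by matching; later
      -- arguments about leaf degrees go through `leaf⁻` and `leaf⁺`.
      leafDegree : ∀ k v → isLeafAt Γ k v ≡ true → degAt Γ k v ≡ 1
      leafDegree k v l with removed Γ k v | degAt Γ k v
      ... | false | suc zero = refl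

    leaf⁻ : ∀ k v → isLeafAt Γ k v ≡ true → removed Γ k v ≡ false × degAt Γ k v ≡ 1
    leaf⁻ k v l = not-true⁻¹ (∧-conicalˡ _ _ l) , leafDegree k v l

    leaf⁺ : ∀ k v → removed Γ k v ≡ false → degAt Γ k v ≡ 1 → isLeafAt Γ k v ≡ true
    leaf⁺ k v r d with removed Γ k v | degAt Γ k v
    leaf⁺ k v refl refl | _ | _ = refl

    isLeafAt-cong : ∀ j k {v w} → removed Γ j v ≡ removed Γ k w → degAt Γ j v ≡ degAt Γ k w →
                    isLeafAt Γ j v ≡ true → isLeafAt Γ k w ≡ true
    isLeafAt-cong j k {v} {w} r d l =
      leaf⁺ k w (trans (sym r) (proj₁ (leaf⁻ j v l))) (trans (sym d) (proj₂ (leaf⁻ j v l)))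

    alive-pred : ∀ k {v} → alive (suc k) v ≡ true → alive k v ≡ true × isLeafAt Γ k v ≡ false
    alive-pred k {v} a with removed Γ k v | isLeafAt Γ k v
    ... | false | false = refl , refl

    alive-suc : ∀ k {v} → alive k v ≡ true → isLeafAt Γ k v ≡ false → alive (suc k) v ≡ true
    alive-suc k {v} a l with removed Γ k v
    alive-suc k {v} a l | false rewrite l = refl

    𝟙-alive : ∀ k v → 𝟙 (alive k v) ≡ 𝟙 (alive (suc k) v) + 𝟙 (isLeafAt Γ k v)
    𝟙-alive k v = split (proj₁ ∘ leaf⁻ k v)
      where
      split : ∀ {r l} → (l ≡ true → r ≡ false) → 𝟙 (not r) ≡ 𝟙 (not (r ∨ l)) + 𝟙 l
      split {true}  {true}  l⇒¬r = contradiction (l⇒¬r refl) λ ()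
      split {true}  {false} _    = refl
      split {false} {true}  _    = refl
      split {false} {false} _    = refl

    adjAt⁺ : ∀ k {v w} → alive k v ≡ true → alive k w ≡ true → adj Γ v w ≡ true → adjAt k v w ≡ true
    adjAt⁺ k av aw e = (av ∧-intro aw) ∧-intro e

    adjAt⁻ : ∀ k {v w} → adjAt k v w ≡ true → alive k v ≡ true × alive k w ≡ true × adj Γ v w ≡ true
    adjAt⁻ k {v} {w} e =
      ∧-conicalˡ _ _ avw , ∧-conicalʳ (alive k v) _ avw , ∧-conicalʳ (alive k v ∧ alive k w) _ e
      where
      avw : alive k v ∧ alive k w ≡ true
      avw = ∧-conicalˡ _ _ e

    adjAt-sym : ∀ k v w → adjAt k v w ≡ adjAt k w v
    adjAt-sym k v w = cong₂ _∧_ (∧-comm (alive k v) _) (adj-sym Γ v w)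

    -- `degAt` asks only the neighbour to be alive, `adjAt` asks it of both ends; for a living `v`
    -- the two counts agree.
    degree : ∀ k {v} → alive k v ≡ true → sum (λ w → 𝟙 (adjAt k v w)) ≡ degAt Γ k v
    degree k {v} a = trans
      (sum-cong-≗ λ w → cong (λ b → 𝟙 ((b ∧ alive k w) ∧ adj Γ v w)) a)
      (sym (count≡sum (λ w → alive k w ∧ adj Γ v w)))

    leafNeighbour-unique : ∀ k {v x y} → isLeafAt Γ k v ≡ true →
                           adjAt k v x ≡ true → adjAt k v y ≡ true → x ≡ y
    leafNeighbour-unique k {v} l ex ey =
      count≡1-unique (proj₂ (leaf⁻ k v l)) (neighbour ex) (neighbour ey)
      where
      neighbour : ∀ {w} → adjAt k v w ≡ true → alive k w ∧ adj Γ v w ≡ true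
      neighbour e = let _ , aw , e′ = adjAt⁻ k e in aw ∧-intro e′

    Walk : ℕ → Fin n → Fin n → Set
    Walk k = Star (λ v w → adjAt k v w ≡ true)

    -- A walk enters and leaves a leaf through the same vertex, so the detour can be cut out.
    avoidLeaves : ∀ k {v w} → Walk k v w → alive (suc k) v ≡ true → alive (suc k) w ≡ true →
                  Walk (suc k) v w
    avoidLeaves k ε av aw = ε
    avoidLeaves k {v} (_◅_ {j = m} e es) av aw with isLeafAt Γ k m in l
    ... | false =
      let am = alive-suc k (proj₁ (proj₂ (adjAt⁻ k e))) l
      in  adjAt⁺ (suc k) av am (proj₂ (proj₂ (adjAt⁻ k e))) ◅ avoidLeaves k es am aw
    -- The walk cannot stop at a leaf, because its target survives the round.
    avoidLeaves k (e ◅ ε) av aw | true = ⊥-elim (true≢false l (proj₂ (alive-pred k aw)))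
    avoidLeaves k {v} (_◅_ {j = m} e (e′ ◅ es)) av aw | true
      with leafNeighbour-unique k l e′ (trans (adjAt-sym k m v) e)
    ... | refl = avoidLeaves k es av aw

    -- Counting vertices and edges through the stages

    edges : ℕ → ℕ
    edges k = sum₂ λ v w → 𝟙 (adjAt k v w)

    vertices : ℕ → ℕ
    vertices k = sum λ v → 𝟙 (alive k v)

    leaves : ℕ → ℕ
    leaves k = sum λ v → 𝟙 (isLeafAt Γ k v)

    vertices-suc : ∀ k → vertices k ≡ vertices (suc k) + leaves k
    vertices-suc k = trans (sum-cong-≗ (𝟙-alive k)) (∑-distrib-+ (λ v → 𝟙 (alive (suc k) v)) _)

    leafEdges : ∀ k → sum₂ (λ v w → 𝟙 (isLeafAt Γ k v) * 𝟙 (adjAt k v w)) ≡ leaves k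
    leafEdges k = sum-cong-≗ λ v → trans
      (sym (*-distribˡ-sum (𝟙 (isLeafAt Γ k v)) (λ w → 𝟙 (adjAt k v w))))
      (atLeaf v)
      where
      atLeaf : ∀ v → 𝟙 (isLeafAt Γ k v) * sum (λ w → 𝟙 (adjAt k v w)) ≡ 𝟙 (isLeafAt Γ k v)
      atLeaf v with isLeafAt Γ k v in l
      ... | false = refl
      ... | true  = let r , d = leaf⁻ k v l in
                    cong (_+ 0) (trans (degree k (not-false r)) d)

    -- An ordered edge lost in round `k` starts or ends at a leaf, and there are `leaves k` of
    -- either kind. An edge between two leaves is counted twice, hence the inequality.
    edges-suc : ∀ k → edges k ≤ edges (suc k) + (leaves k + leaves k)
    edges-suc k = begin
      edges k                                       ≤⟨ sum₂-mono splitEdge ⟩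
      sum₂ (λ v w → a v w + (ℓ v w + ℓ w v))        ≡⟨ sum₂-+ a _ ⟩
      edges (suc k) + sum₂ (λ v w → ℓ v w + ℓ w v)  ≡⟨ cong (edges (suc k) +_) (sum₂-+ ℓ _) ⟩
      edges (suc k) + (sum₂ ℓ + sum₂ (λ v w → ℓ w v))
        ≡⟨ cong (λ x → edges (suc k) + (sum₂ ℓ + x)) (∑-comm (λ v w → ℓ w v)) ⟩
      edges (suc k) + (sum₂ ℓ + sum₂ ℓ)
        ≡⟨ cong (λ x → edges (suc k) + (x + x)) (leafEdges k) ⟩
      edges (suc k) + (leaves k + leaves k)         ∎
      where
      open ≤-Reasoning
      a ℓ : Fin n → Fin n → ℕ
      a v w = 𝟙 (adjAt (suc k) v w)
      ℓ v w = 𝟙 (isLeafAt Γ k v) * 𝟙 (adjAt k v w)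
      𝟙*1 : ∀ {b} → b ≡ true → 1 ≤ 𝟙 b * 1
      𝟙*1 refl = s≤s z≤n
      splitEdge : ∀ v w → 𝟙 (adjAt k v w) ≤ a v w + (ℓ v w + ℓ w v)
      splitEdge v w rewrite adjAt-sym k w v with adjAt k v w in e
      ... | false = z≤n
      ... | true with adjAt⁻ k e | isLeafAt Γ k v ≟ᵇ true | isLeafAt Γ k w ≟ᵇ true
      ...   | _ | yes lv | _ =
        ≤-trans (𝟙*1 lv) (≤-trans (m≤m+n _ _) (m≤n+m _ (a v w)))
      ...   | _ | no _ | yes lw =
        ≤-trans (𝟙*1 lw) (≤-trans (m≤n+m _ (𝟙 (isLeafAt Γ k v) * 1)) (m≤n+m _ (a v w)))
      ...   | av , aw , e′ | no ¬lv | no ¬lw = ≤-trans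
        (𝟙-true (adjAt⁺ (suc k) (alive-suc k av (¬-not ¬lv)) (alive-suc k aw (¬-not ¬lw)) e′))
        (m≤m+n _ _)

    -- `numEdges` keeps one order of each pair; by asymmetry of `<ᵇ` the chosen pairs and their
    -- reversals are disjoint.
    doubleEdges : numEdges Γ + numEdges Γ ≤ edges 0
    doubleEdges = begin
      numEdges Γ + numEdges Γ            ≡⟨ cong₂ _+_ numEdges≡ (trans numEdges≡ (∑-comm e)) ⟩
      sum₂ e + sum₂ (λ v w → e w v)      ≡⟨ sum₂-+ e _ ⟨
      sum₂ (λ v w → e v w + e w v)       ≤⟨ sum₂-mono oneOrder ⟩
      edges 0                            ∎
      where
      open ≤-Reasoning
      e : Fin n → Fin n → ℕ
      e v w = 𝟙 (adj Γ v w ∧ (toℕ v <ᵇ toℕ w))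
      numEdges≡ : numEdges Γ ≡ sum₂ e
      numEdges≡ = trans (listSum (λ v → count (λ w → adj Γ v w ∧ (toℕ v <ᵇ toℕ w))) id)
                        (sum-cong-≗ λ v → count≡sum (λ w → adj Γ v w ∧ (toℕ v <ᵇ toℕ w)))
      <ᵇ-asym : ∀ i j → 𝟙 (i <ᵇ j) + 𝟙 (j <ᵇ i) ≤ 1
      <ᵇ-asym zero    zero    = z≤n
      <ᵇ-asym zero    (suc j) = s≤s z≤n
      <ᵇ-asym (suc i) zero    = s≤s z≤n
      <ᵇ-asym (suc i) (suc j) = <ᵇ-asym i j
      oneOrder : ∀ v w → e v w + e w v ≤ 𝟙 (adjAt 0 v w)
      oneOrder v w rewrite adj-sym Γ w v with adj Γ v w
      ... | false = z≤n
      ... | true  = <ᵇ-asym (toℕ v) (toℕ w)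

    -- edges counts ordered pairs, whence the factor 2.
    excess : 2 ≤ betti1Connected Γ → ∀ k → vertices k + vertices k + 2 ≤ edges k
    excess b zero = begin
      vertices 0 + vertices 0 + 2  ≤⟨ +-monoˡ-≤ 2 (+-mono-≤ (sum-𝟙≤ (alive 0)) (sum-𝟙≤ (alive 0))) ⟩
      n + n + 2                    ≡⟨ rearrange n ⟩
      (1 + n) + (1 + n)            ≤⟨ +-mono-≤ n<E n<E ⟩
      numEdges Γ + numEdges Γ      ≤⟨ doubleEdges ⟩
      edges 0                      ∎
      where
      open ≤-Reasoning
      rearrange : ∀ n → n + n + 2 ≡ (1 + n) + (1 + n)
      rearrange = solve-∀
      -- The Betti number is a truncated difference. Being nonzero, it is a true one, and adding `n`
      -- back is then exact.
      n<E+1 : n ℕ.< numEdges Γ + 1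
      n<E+1 = m∸n≢0⇒n<m λ eq → contradiction (subst (2 ≤_) eq b) λ ()
      n<E : 1 + n ≤ numEdges Γ
      n<E = +-cancelʳ-≤ 1 (1 + n) _ (begin
        1 + n + 1                  ≡⟨ +-comm (1 + n) 1 ⟩
        2 + n                      ≤⟨ +-monoˡ-≤ n b ⟩
        betti1Connected Γ + n      ≡⟨ m∸n+n≡m {numEdges Γ + 1} {n} (<⇒≤ n<E+1) ⟩
        numEdges Γ + 1             ∎)
    excess b (suc k) = +-cancelʳ-≤ (leaves k + leaves k) _ _ (begin
      V + V + 2 + (L + L)          ≡⟨ rearrange V L ⟩
      (V + L) + (V + L) + 2        ≡⟨ cong (λ x → x + x + 2) (vertices-suc k) ⟨
      vertices k + vertices k + 2  ≤⟨ excess b k ⟩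
      edges k                      ≤⟨ edges-suc k ⟩
      edges (suc k) + (L + L)      ∎)
      where
      open ≤-Reasoning
      V = vertices (suc k)
      L = leaves k
      rearrange : ∀ v l → v + v + 2 + (l + l) ≡ (v + l) + (v + l) + 2
      rearrange = solve-∀

    -- Stabilisation of leaf removal

    Leafless : ℕ → Set
    Leafless k = ∀ v → isLeafAt Γ k v ≡ false

    -- A round that finds a leaf removes a vertex, and a round that finds none changes nothing, so
    -- no leaf appears later. At `k = n` the second alternative leaves no vertex at all.
    stableOrShrinking : ∀ k → Leafless k ⊎ vertices k + k ≤ n
    stableOrShrinking zero = inj₂ (subst (_≤ n) (sym (+-identityʳ _)) (sum-𝟙≤ (alive 0)))
    stableOrShrinking (suc k) = go (Fin.any? (λ v → isLeafAt Γ k v ≟ᵇ true)) (stableOrShrinking k)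
      where
      persists : Leafless k → Leafless (suc k)
      persists none v = ¬-not λ l → true≢false (isLeafAt-cong (suc k) k (same v) sameDegree l) (none v)
        where
        same : ∀ w → removed Γ (suc k) w ≡ removed Γ k w
        same w = trans (cong (removed Γ k w ∨_) (none w)) (∨-identityʳ (removed Γ k w))
        sameDegree : degAt Γ (suc k) v ≡ degAt Γ k v
        sameDegree = count-cong λ w → cong (λ r → not r ∧ adj Γ v w) (same w)
      go : Dec (∃ λ v → isLeafAt Γ k v ≡ true) → Leafless k ⊎ vertices k + k ≤ n →
           Leafless (suc k) ⊎ vertices (suc k) + suc k ≤ n
      go (no none) _ = inj₁ (persists λ v → ¬-not λ l → none (v , l))
      go (yes _) (inj₁ none) = inj₁ (persists none)
      go (yes (v , l)) (inj₂ V+k≤n) = inj₂ (begin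
        vertices (suc k) + suc k            ≡⟨ +-assoc (vertices (suc k)) 1 k ⟨
        vertices (suc k) + 1 + k
          ≤⟨ +-monoˡ-≤ k (+-monoʳ-≤ (vertices (suc k)) (≤-trans (𝟙-true l) (term≤sum _ v))) ⟩
        vertices (suc k) + leaves k + k     ≡⟨ cong (_+ k) (vertices-suc k) ⟨
        vertices k + k                      ≤⟨ V+k≤n ⟩
        n                                   ∎)
        where open ≤-Reasoning

    coreHasNoLeaf : ∀ {v} → isLeafAt Γ n v ≡ true → ⊥
    coreHasNoLeaf {v} l with stableOrShrinking n
    ... | inj₁ none  = true≢false l (none v)
    ... | inj₂ V+n≤n = contradiction (begin
      1                ≤⟨ 𝟙-true (not-false (proj₁ (leaf⁻ n v l))) ⟩
      𝟙 (alive n v)    ≤⟨ term≤sum (λ v → 𝟙 (alive n v)) v ⟩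
      vertices n       ≤⟨ +-cancelʳ-≤ n _ 0 V+n≤n ⟩
      0                ∎) λ ()
      where open ≤-Reasoning

    -- Connectedness and degrees of the stages

    module _ (conn : Connected Γ) where

      connectedAt : ∀ k {v w} → alive k v ≡ true → alive k w ≡ true → Walk k v w
      connectedAt zero {v} {w} _ _ = fromReach (conn v w)
        where
        fromReach : ∀ {v w} → Reach Γ v w → Walk 0 v w
        fromReach here       = ε
        fromReach (step e r) = e ◅ fromReach r
      connectedAt (suc k) av aw =
        avoidLeaves k (connectedAt k (proj₁ (alive-pred k av)) (proj₁ (alive-pred k aw))) av aw

      -- Two adjacent leaves have only each other as neighbours, so a walk starting at one of them
      -- never reaches the survivor `c`.
      leavesNotAdjacent : ∀ k {v w c} → alive (suc k) c ≡ true → adjAt k v w ≡ true →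
                          isLeafAt Γ k v ≡ true → isLeafAt Γ k w ≡ true → ⊥
      leavesNotAdjacent k {v} {w} {c} ac e lv lw =
        stuck (connectedAt k (proj₁ (adjAt⁻ k e)) (proj₁ (alive-pred k ac))) (inj₁ refl)
        where
        c≢leaf : ∀ {x} → isLeafAt Γ k x ≡ true → x ≢ c
        c≢leaf l refl = true≢false l (proj₂ (alive-pred k ac))
        stuck : ∀ {x} → Walk k x c → x ≡ v ⊎ x ≡ w → ⊥
        stuck ε (inj₁ refl) = c≢leaf lv refl
        stuck ε (inj₂ refl) = c≢leaf lw refl
        stuck (e′ ◅ es) (inj₁ refl) = stuck es (inj₂ (leafNeighbour-unique k lv e′ e))
        stuck (e′ ◅ es) (inj₂ refl) =
          stuck es (inj₁ (leafNeighbour-unique k lw e′ (trans (adjAt-sym k w v) e)))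

      module _ (b : 2 ≤ betti1Connected Γ) where

        -- By `excess` every stage keeps at least two ordered edges, so the graph is never
        -- exhausted.
        edgeAt : ∀ k → ∃ λ v → ∃ λ w → adjAt k v w ≡ true
        edgeAt k with sum₂-positive _ (≤-trans (≤-trans (s≤s z≤n) (m≤n+m 2 _)) (excess b k))
        ... | v , w , 1≤ = v , w , 𝟙-positive 1≤

        -- Take the first step of a walk from `v` to an end of some edge; if the walk is empty, `v`
        -- is that end.
        neighbourAt : ∀ k {v} → alive k v ≡ true → ∃ λ w → adjAt k v w ≡ true
        neighbourAt k {v} av with edgeAt k
        ... | x , y , e with connectedAt k av (proj₁ (adjAt⁻ k e))
        ...   | ε      = y , e
        ...   | e′ ◅ _ = _ , e′

        -- Degree one would make `v` a leaf of the core, and degree zero is excluded by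
        -- `neighbourAt`.
        coreDegree : ∀ {v} → alive n v ≡ true → 2 ≤ sum (λ w → 𝟙 (adjAt n v w))
        coreDegree {v} av with sum (λ w → 𝟙 (adjAt n v w)) in d
        ... | suc (suc _) = s≤s (s≤s z≤n)
        ... | suc zero    = ⊥-elim (coreHasNoLeaf
          (leaf⁺ n v (not-true⁻¹ av) (trans (sym (degree n av)) d)))
        ... | zero        = contradiction (begin
          1                              ≤⟨ 𝟙-true (proj₂ (neighbourAt n av)) ⟩
          𝟙 (adjAt n v w)                ≤⟨ term≤sum (λ w → 𝟙 (adjAt n v w)) w ⟩
          sum (λ w → 𝟙 (adjAt n v w))    ≡⟨ d ⟩
          0                              ∎) λ ()
          where
          open ≤-Reasoning
          w = proj₁ (neighbourAt n av)

-- Sums of rationals and the embedding of the naturals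

module _ where
  open import Data.Rational using (ℚ; _+_; _*_; _-_; -_; 0ℚ; 1ℚ) renaming (_≤_ to _≤ℚ_)
  open import Data.Rational.Properties
  open import Data.Rational.Solver using (module +-*-Solver)
  open +-*-Solver using (solve; _:=_; _:+_; _:*_; _:-_; :-_; con)
  open import Algebra.Properties.Semiring.Sum (CommutativeRing.semiring +-*-commutativeRing)
  open import Algebra.Properties.Semiring.Mult (CommutativeRing.semiring +-*-commutativeRing)
    using (×-homo-+; ×1-homo-*) renaming (_×_ to _×ℚ_)
  open ≡-Reasoning

  ι : ℕ → ℚ
  ι k = k ×ℚ 1ℚ

  ι-nonNegative : ∀ k → 0ℚ ≤ℚ ι k
  ι-nonNegative zero    = ≤-refl
  ι-nonNegative (suc k) = ≤-trans (ι-nonNegative k)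
    (subst (_≤ℚ 1ℚ + ι k) (+-identityˡ (ι k)) (+-monoˡ-≤ (ι k) (<⇒≤ (positive⁻¹ 1ℚ))))

  ι-suc≢0 : ∀ k → ι (suc k) ≢ 0ℚ
  ι-suc≢0 k eq = <-irrefl (sym eq) (+-mono-<-≤ (positive⁻¹ 1ℚ) (ι-nonNegative k))

  -- Carries the Lefschetz formula, which is proved over the rationals, back to natural numbers.
  ι-injective : ∀ {k l} → ι k ≡ ι l → k ≡ l
  ι-injective {zero}  {zero}  _  = refl
  ι-injective {zero}  {suc l} eq = contradiction (sym eq) (ι-suc≢0 l)
  ι-injective {suc k} {zero}  eq = contradiction eq (ι-suc≢0 k)
  ι-injective {suc k} {suc l} eq =
    cong suc (ι-injective (Group.∙-cancelˡ (CommutativeRing.+-group +-*-commutativeRing) 1ℚ _ _ eq))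

  ι-+ : ∀ k l → ι (k ℕ.+ l) ≡ ι k + ι l
  ι-+ = ×-homo-+ 1ℚ

  ι-* : ∀ k l → ι (k ℕ.* l) ≡ ι k * ι l
  ι-* = ×1-homo-*

  ι-sum : ∀ {n} (f : Fin n → ℕ) → ι (ℕ∑.sum f) ≡ sum (ι ∘ f)
  ι-sum {zero}  f = refl
  ι-sum {suc n} f = trans (ι-+ (f zero) _) (cong (ι (f zero) +_) (ι-sum (f ∘ suc)))

  sum-sub : ∀ {n} (f g : Fin n → ℚ) → sum (λ i → f i - g i) ≡ sum f - sum g
  sum-sub {zero}  f g = refl
  sum-sub {suc n} f g = trans
    (cong (f zero - g zero +_) (sum-sub (f ∘ suc) (g ∘ suc)))
    (solve 4 (λ a b c d → ((a :- b) :+ (c :- d)) := ((a :+ c) :- (b :+ d))) refl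
      (f zero) (g zero) _ _)

  ∑∑ : ∀ {m n} → (Fin m → Fin n → ℚ) → ℚ
  ∑∑ F = sum λ i → sum (F i)

  ∑∑-cong : ∀ {m n} {F G : Fin m → Fin n → ℚ} → (∀ i j → F i j ≡ G i j) → ∑∑ F ≡ ∑∑ G
  ∑∑-cong F≡G = sum-cong-≗ λ i → sum-cong-≗ (F≡G i)

  ∑∑-sub : ∀ {m n} (F G : Fin m → Fin n → ℚ) → ∑∑ (λ i j → F i j - G i j) ≡ ∑∑ F - ∑∑ G
  ∑∑-sub F G = trans (sum-cong-≗ λ i → sum-sub (F i) (G i)) (sum-sub (λ i → sum (F i)) _)

  *-∑∑ : ∀ {m n} x (F : Fin m → Fin n → ℚ) → x * ∑∑ F ≡ ∑∑ (λ i j → x * F i j)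
  *-∑∑ x F = trans (*-distribˡ-sum x (λ i → sum (F i))) (sum-cong-≗ λ i → *-distribˡ-sum x (F i))

  sum-∑∑-comm : ∀ {l m n} (F : Fin l → Fin m → Fin n → ℚ) →
                sum (λ k → ∑∑ (F k)) ≡ ∑∑ (λ i j → sum λ k → F k i j)
  sum-∑∑-comm F = trans (∑-comm λ k i → sum (F k i)) (sum-cong-≗ λ i → ∑-comm λ k j → F k i j)

  ι-∑∑ : ∀ {m n} (f : Fin m → Fin n → ℕ) → ι (sum₂ f) ≡ ∑∑ (λ i j → ι (f i j))
  ι-∑∑ f = trans (ι-sum λ i → ℕ∑.sum (f i)) (sum-cong-≗ λ i → ι-sum (f i))

  [_] : Bool → ℚ
  [ b ] = ι (𝟙 b)

  []-true : ∀ {b} → b ≡ true → [ b ] ≡ 1ℚ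
  []-true refl = refl

  -- Edge forms

  module _ {n : ℕ} where

    -- Kronecker delta, written so that it is by definition the image under `ι` of the indicators
    -- that count fixed and flipped edges.
    δ : Fin n → Fin n → ℚ
    δ v x = [ does (v Fin.≟ x) ]

    δ-refl : ∀ v → δ v v ≡ 1ℚ
    δ-refl v with v Fin.≟ v
    ... | yes _   = refl
    ... | no  v≢v = contradiction refl v≢v

    δ-≢ : ∀ {v x} → v ≢ x → δ v x ≡ 0ℚ
    δ-≢ {v} {x} v≢x with v Fin.≟ x
    ... | yes v≡x = contradiction v≡x v≢x
    ... | no  _   = refl

    -- For distinct `p` and `q`, the 1-form with value 1 on `(p , q)`, -1 on `(q , p)` and 0 on all
    -- other pairs.
    edgeForm : Fin n → Fin n → Fin n → Fin n → ℚ
    edgeForm p q x y = δ p x * δ q y - δ p y * δ q x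

  edgeForm-antisym : ∀ {n} (p q x y : Fin n) → edgeForm p q x y ≡ - edgeForm p q y x
  edgeForm-antisym p q x y = solve 2 (λ s t → (s :- t) := (:- (t :- s))) refl
    (δ p x * δ q y) (δ p y * δ q x)

  sift : ∀ {n} (F : Fin n → ℚ) x → sum (λ p → δ p x * F p) ≡ F x
  sift F zero = begin
    1ℚ * F zero + sum (λ p → 0ℚ * F (suc p))
      ≡⟨ cong₂ _+_ (*-identityˡ (F zero)) (sym (*-distribˡ-sum 0ℚ (F ∘ suc))) ⟩
    F zero + 0ℚ * sum (F ∘ suc)  ≡⟨ cong (F zero +_) (*-zeroˡ (sum (F ∘ suc))) ⟩
    F zero + 0ℚ                  ≡⟨ +-identityʳ (F zero) ⟩
    F zero                       ∎
  sift F (suc x) = begin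
    0ℚ * F zero + sum (λ p → δ p x * F (suc p))
      ≡⟨ cong (_+ sum (λ p → δ p x * F (suc p))) (*-zeroˡ (F zero)) ⟩
    0ℚ + sum (λ p → δ p x * F (suc p))           ≡⟨ +-identityˡ _ ⟩
    sum (λ p → δ p x * F (suc p))                ≡⟨ sift (F ∘ suc) x ⟩
    F (suc x)                                    ∎

  sift₂ : ∀ {n} (F : Fin n → Fin n → ℚ) x y → ∑∑ (λ p q → F p q * (δ p x * δ q y)) ≡ F x y
  sift₂ F x y = begin
    ∑∑ (λ p q → F p q * (δ p x * δ q y))
      ≡⟨ ∑∑-cong (λ p q → solve 3 (λ f a b → (f :* (a :* b)) := (a :* (b :* f))) refl
                                (F p q) (δ p x) (δ q y)) ⟩
    ∑∑ (λ p q → δ p x * (δ q y * F p q))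
      ≡⟨ sum-cong-≗ (λ p → sym (*-distribˡ-sum (δ p x) (λ q → δ q y * F p q))) ⟩
    sum (λ p → δ p x * sum (λ q → δ q y * F p q))
      ≡⟨ sift (λ p → sum (λ q → δ q y * F p q)) x ⟩
    sum (λ q → δ q y * F x q)             ≡⟨ sift (F x) y ⟩
    F x y                                 ∎

  -- The combination of edge forms with coefficients `F` is the antisymmetrisation of `F`. This
  -- makes any form an explicit combination of edge forms, for which potentials are given.
  evaluate : ∀ {n} (F : Fin n → Fin n → ℚ) x y →
             ∑∑ (λ p q → F p q * edgeForm p q x y) ≡ F x y - F y x
  evaluate F x y = begin
    ∑∑ (λ p q → F p q * edgeForm p q x y)
      ≡⟨ ∑∑-cong (λ p q → solve 5 (λ f a b c d →
           (f :* ((a :* b) :- (c :* d))) := ((f :* (a :* b)) :- (f :* (c :* d)))) refl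
           (F p q) (δ p x) (δ q y) (δ p y) (δ q x)) ⟩
    ∑∑ (λ p q → F p q * (δ p x * δ q y) - F p q * (δ p y * δ q x))
      ≡⟨ ∑∑-sub (λ p q → F p q * (δ p x * δ q y)) _ ⟩
    ∑∑ (λ p q → F p q * (δ p x * δ q y)) - ∑∑ (λ p q → F p q * (δ p y * δ q x))
      ≡⟨ cong₂ _-_ (sift₂ F x y) (sift₂ F y x) ⟩
    F x y - F y x ∎

  -- The Lefschetz formula for a map `g` of a connected graph with vertices `P` and edges `A`

  module Trace {n : ℕ} (P : Fin n → Bool) (A : Fin n → Fin n → Bool)
    (A-sym : ∀ v w → A v w ≡ A w v) (A-irrefl : ∀ v → A v v ≡ false)
    (A⇒P : ∀ {v w} → A v w ≡ true → P v ≡ true)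
    (connected : ∀ {v w} → P v ≡ true → P w ≡ true → Star (λ x y → A x y ≡ true) v w)
    (g : Fin n → Fin n) (P-g : ∀ v → P (g v) ≡ P v) (A-g : ∀ v w → A (g v) (g w) ≡ A v w)
    (u : Fin n → Fin n → Fin n → ℚ)
    (u-potential : ∀ p q {x y} → A x y ≡ true →
                   edgeForm p q (g x) (g y) - edgeForm p q x y ≡ u p q y - u p q x)
    {r : Fin n} (Pr : P r ≡ true)
    where

    fixedEdges flippedEdges allEdges fixedVertices allVertices : ℕ
    fixedEdges    = sum₂ λ p q → 𝟙 (A p q) ℕ.* (𝟙 (does (p Fin.≟ g p)) ℕ.* 𝟙 (does (q Fin.≟ g q)))
    flippedEdges  = sum₂ λ p q → 𝟙 (A p q) ℕ.* (𝟙 (does (p Fin.≟ g q)) ℕ.* 𝟙 (does (q Fin.≟ g p)))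
    allEdges      = sum₂ λ p q → 𝟙 (A p q)
    fixedVertices = ℕ∑.sum λ v → 𝟙 (P v) ℕ.* 𝟙 (does (v Fin.≟ g v))
    allVertices   = ℕ∑.sum λ v → 𝟙 (P v)

    private
      -- The coboundary of the indicator of v is half the sum of c v p q · edgeForm p q.
      c : Fin n → Fin n → Fin n → ℚ
      c v p q = [ A p q ] * (δ v q - δ v p)

      -- U v and Z v are two potentials of twice g* D 1_v − D 1_v.
      U Z : Fin n → Fin n → ℚ
      U v x = ∑∑ λ p q → c v p q * u p q x
      Z v x = (δ v (g x) + δ v (g x)) - (δ v x + δ v x)

      U-diff : ∀ v x y → U v y - U v x ≡ ∑∑ (λ p q → c v p q * (u p q y - u p q x))
      U-diff v x y = trans (sym (∑∑-sub (λ p q → c v p q * u p q y) _))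
        (∑∑-cong λ p q → solve 3 (λ c s t → ((c :* s) :- (c :* t)) := (c :* (s :- t))) refl
                               (c v p q) (u p q y) (u p q x))

      -- Both orders of the edge contribute the same difference, which is where the factor two in
      -- `Z` comes from.
      c-edge : ∀ v {x y} → A x y ≡ true → c v x y - c v y x ≡ (δ v y + δ v y) - (δ v x + δ v x)
      c-edge v {x} {y} e = begin
        c v x y - c v y x
          ≡⟨ cong₂ (λ s t → s * (δ v y - δ v x) - t * (δ v x - δ v y))
                   ([]-true e) ([]-true (trans (A-sym y x) e)) ⟩
        1ℚ * (δ v y - δ v x) - 1ℚ * (δ v x - δ v y)
          ≡⟨ solve 2 (λ s t → ((con 1ℚ :* (s :- t)) :- (con 1ℚ :* (t :- s)))
                              := ((s :+ s) :- (t :+ t))) refl (δ v y) (δ v x) ⟩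
        (δ v y + δ v y) - (δ v x + δ v x) ∎

      -- By linearity the increment of `U v` is the form with coefficients `c v`, taken on the image
      -- edge minus taken on the edge itself; `evaluate` computes both values.
      U-Z-edge : ∀ v {x y} → A x y ≡ true → U v y - U v x ≡ Z v y - Z v x
      U-Z-edge v {x} {y} e = begin
        U v y - U v x                                   ≡⟨ U-diff v x y ⟩
        ∑∑ (λ p q → c v p q * (u p q y - u p q x))
          ≡⟨ ∑∑-cong (λ p q → trans (cong (c v p q *_) (sym (u-potential p q e)))
               (solve 3 (λ c s t → (c :* (s :- t)) := ((c :* s) :- (c :* t))) refl
                      (c v p q) (edgeForm p q (g x) (g y)) (edgeForm p q x y))) ⟩
        ∑∑ (λ p q → c v p q * edgeForm p q (g x) (g y) - c v p q * edgeForm p q x y)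
          ≡⟨ ∑∑-sub (λ p q → c v p q * edgeForm p q (g x) (g y)) _ ⟩
        ∑∑ (λ p q → c v p q * edgeForm p q (g x) (g y)) - ∑∑ (λ p q → c v p q * edgeForm p q x y)
          ≡⟨ cong₂ _-_ (trans (evaluate (c v) (g x) (g y)) (c-edge v (trans (A-g x y) e)))
                       (trans (evaluate (c v) x y) (c-edge v e)) ⟩
        ((δ v (g y) + δ v (g y)) - (δ v (g x) + δ v (g x))) - ((δ v y + δ v y) - (δ v x + δ v x))
          ≡⟨ solve 4 (λ a b c d → (((a :+ a) :- (b :+ b)) :- ((c :+ c) :- (d :+ d)))
                                  := (((a :+ a) :- (c :+ c)) :- ((b :+ b) :- (d :+ d)))) refl
                   (δ v (g y)) (δ v (g x)) (δ v y) (δ v x) ⟩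
        Z v y - Z v x ∎

      -- On a connected graph two potentials of the same form differ by a constant.
      U-Z : ∀ v {x y} → Star (λ x y → A x y ≡ true) x y → U v y - U v x ≡ Z v y - Z v x
      U-Z v {x} ε = trans (+-inverseʳ (U v x)) (sym (+-inverseʳ (Z v x)))
      U-Z v {x} {y} (_◅_ {j = m} e es) = begin
        U v y - U v x                        ≡⟨ telescope (U v y) (U v m) (U v x) ⟩
        (U v y - U v m) + (U v m - U v x)    ≡⟨ cong₂ _+_ (U-Z v es) (U-Z-edge v e) ⟩
        (Z v y - Z v m) + (Z v m - Z v x)    ≡⟨ telescope (Z v y) (Z v m) (Z v x) ⟨
        Z v y - Z v x                        ∎
        where
        telescope : ∀ a b c → a - c ≡ (a - b) + (b - c)
        telescope = solve 3 (λ a b c → (a :- c) := ((a :- b) :+ (b :- c))) refl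

      -- Twice the trace of g* - 1 on the 1-forms of the graph: the increment of `u p q` along its
      -- own edge is the diagonal entry at that edge, and each edge occurs in both orders.
      L : ℚ
      L = ∑∑ λ p q → [ A p q ] * (u p q q - u p q p)

      -- On its own edge the pulled back edge form is 1 if `g` fixes both ends, -1 if it swaps them
      -- and 0 otherwise; subtracting the form itself takes away 1.
      L-edges : L ≡ ι fixedEdges - ι flippedEdges - ι allEdges
      L-edges = begin
        L                                      ≡⟨ ∑∑-cong pointwise ⟩
        ∑∑ (λ p q → ι (f p q) - ι (h p q) - [ A p q ])
          ≡⟨ ∑∑-sub (λ p q → ι (f p q) - ι (h p q)) _ ⟩
        ∑∑ (λ p q → ι (f p q) - ι (h p q)) - ∑∑ (λ p q → [ A p q ])
          ≡⟨ cong (_- _) (∑∑-sub (λ p q → ι (f p q)) _) ⟩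
        ∑∑ (λ p q → ι (f p q)) - ∑∑ (λ p q → ι (h p q)) - ∑∑ (λ p q → [ A p q ])
          ≡⟨ cong₂ _-_ (cong₂ _-_ (ι-∑∑ f) (ι-∑∑ h)) (ι-∑∑ (λ p q → 𝟙 (A p q))) ⟨
        ι fixedEdges - ι flippedEdges - ι allEdges ∎
        where
        f h : Fin n → Fin n → ℕ
        f p q = 𝟙 (A p q) ℕ.* (𝟙 (does (p Fin.≟ g p)) ℕ.* 𝟙 (does (q Fin.≟ g q)))
        h p q = 𝟙 (A p q) ℕ.* (𝟙 (does (p Fin.≟ g q)) ℕ.* 𝟙 (does (q Fin.≟ g p)))
        edgeForm-self : ∀ {p q} → A p q ≡ true → edgeForm p q p q ≡ 1ℚ
        edgeForm-self {p} {q} e = begin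
          δ p p * δ q q - δ p q * δ q p
            ≡⟨ cong₂ _-_ (cong₂ _*_ (δ-refl p) (δ-refl q)) (cong (_* δ q p) (δ-≢ p≢q)) ⟩
          1ℚ * 1ℚ - 0ℚ * δ q p           ≡⟨ cong (λ x → 1ℚ - x) (*-zeroˡ (δ q p)) ⟩
          1ℚ                             ∎
          where
          p≢q : p ≢ q
          p≢q refl = true≢false e (A-irrefl p)
        ι-** : ∀ i j k → ι (i ℕ.* (j ℕ.* k)) ≡ ι i * (ι j * ι k)
        ι-** i j k = trans (ι-* i (j ℕ.* k)) (cong (ι i *_) (ι-* j k))
        -- The potential equation is available on edges only; elsewhere the factor `[ b ]` is zero.
        -- The Boolean is a separate argument so that it can be split on.
        shift : ∀ {p q} b → A p q ≡ b →
                [ b ] * (u p q q - u p q p) ≡ [ b ] * (edgeForm p q (g p) (g q) - 1ℚ)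
        shift {p} {q} false _ = trans (*-zeroˡ (u p q q - u p q p))
          (sym (*-zeroˡ (edgeForm p q (g p) (g q) - 1ℚ)))
        shift {p} {q} true e = cong (1ℚ *_) (trans (sym (u-potential p q e))
          (cong (λ x → edgeForm p q (g p) (g q) - x) (edgeForm-self e)))
        pointwise : ∀ p q → [ A p q ] * (u p q q - u p q p) ≡ ι (f p q) - ι (h p q) - [ A p q ]
        pointwise p q = begin
          [ A p q ] * (u p q q - u p q p)                     ≡⟨ shift (A p q) refl ⟩
          [ A p q ] * (edgeForm p q (g p) (g q) - 1ℚ)
            ≡⟨ solve 5 (λ e a b c d → (e :* (((a :* b) :- (c :* d)) :- con 1ℚ))
                 := (((e :* (a :* b)) :- (e :* (c :* d))) :- e)) refl
                 [ A p q ] (δ p (g p)) (δ q (g q)) (δ p (g q)) (δ q (g p)) ⟩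
          [ A p q ] * (δ p (g p) * δ q (g q)) - [ A p q ] * (δ p (g q) * δ q (g p)) - [ A p q ]
            ≡⟨ cong₂ (λ x y → x - y - [ A p q ])
                 (ι-** (𝟙 (A p q)) (𝟙 (does (p Fin.≟ g p))) (𝟙 (does (q Fin.≟ g q))))
                 (ι-** (𝟙 (A p q)) (𝟙 (does (p Fin.≟ g q))) (𝟙 (does (q Fin.≟ g p)))) ⟨
          ι (f p q) - ι (h p q) - [ A p q ] ∎

      -- Summation by parts: the sum over `v` of the factor `δ v q - δ v p` in `c v p q` picks out
      -- the two ends of the edge. The value at the base point `r` cancels between them; it is
      -- inserted so that only differences of `U v` occur, and `U-Z` can replace those.
      L-potentials : L ≡ sum (λ v → [ P v ] * (U v v - U v r))
      L-potentials = sym (begin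
        sum (λ v → [ P v ] * (U v v - U v r))
          ≡⟨ sum-cong-≗ (λ v → trans (cong ([ P v ] *_) (U-diff v r v))
                                     (*-∑∑ [ P v ] (λ p q → c v p q * (u p q v - u p q r)))) ⟩
        sum (λ v → ∑∑ (λ p q → [ P v ] * (c v p q * (u p q v - u p q r))))
          ≡⟨ sum-∑∑-comm (λ v p q → [ P v ] * (c v p q * (u p q v - u p q r))) ⟩
        ∑∑ (λ p q → sum (λ v → [ P v ] * (c v p q * (u p q v - u p q r))))
          ≡⟨ ∑∑-cong inner ⟩
        L ∎)
        where
        ends : ∀ {p q} b → A p q ≡ b → ∀ s t w →
               [ P q ] * ([ b ] * (s - w)) - [ P p ] * ([ b ] * (t - w)) ≡ [ b ] * (s - t)
        ends {p} {q} false _ s t w =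
          solve 5 (λ a b s t w → ((a :* (con 0ℚ :* (s :- w))) :- (b :* (con 0ℚ :* (t :- w))))
                                 := (con 0ℚ :* (s :- t))) refl [ P q ] [ P p ] s t w
        ends {p} {q} true e s t w = trans
          (cong₂ (λ x y → x * (1ℚ * (s - w)) - y * (1ℚ * (t - w)))
                 ([]-true (A⇒P (trans (A-sym q p) e))) ([]-true (A⇒P e)))
          (solve 3 (λ s t w → ((con 1ℚ :* (con 1ℚ :* (s :- w))) :- (con 1ℚ :* (con 1ℚ :* (t :- w))))
                              := (con 1ℚ :* (s :- t))) refl s t w)
        inner : ∀ p q → sum (λ v → [ P v ] * (c v p q * (u p q v - u p q r)))
                        ≡ [ A p q ] * (u p q q - u p q p)
        inner p q = begin
          sum (λ v → [ P v ] * (c v p q * (u p q v - u p q r)))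
            ≡⟨ sum-cong-≗ (λ v → solve 5 (λ P a x y s → (P :* ((a :* (x :- y)) :* s))
                    := ((x :* (P :* (a :* s))) :- (y :* (P :* (a :* s))))) refl
                    [ P v ] [ A p q ] (δ v q) (δ v p) (u p q v - u p q r)) ⟩
          sum (λ v → δ v q * F v - δ v p * F v)      ≡⟨ sum-sub (λ v → δ v q * F v) _ ⟩
          sum (λ v → δ v q * F v) - sum (λ v → δ v p * F v)
            ≡⟨ cong₂ _-_ (sift F q) (sift F p) ⟩
          F q - F p                                  ≡⟨ ends (A p q) refl (u p q q) (u p q p) (u p q r) ⟩
          [ A p q ] * (u p q q - u p q p) ∎
          where
          F : Fin n → ℚ
          F v = [ P v ] * ([ A p q ] * (u p q v - u p q r))

      -- With `Z` in place of `U`, the terms at `v` count fixed vertices minus all vertices, twice.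
      -- The terms at the base point cancel in total, because `g r` and `r` are both vertices of the
      -- graph and each is hit exactly once.
      L-vertices : L ≡ (ι fixedVertices + ι fixedVertices) - (ι allVertices + ι allVertices)
      L-vertices = begin
        L                                                   ≡⟨ L-potentials ⟩
        sum (λ v → [ P v ] * (U v v - U v r))               ≡⟨ sum-cong-≗ (λ v → atVertex v (P v) refl) ⟩
        sum (λ v → [ P v ] * (Z v v - Z v r))               ≡⟨ sum-cong-≗ expand ⟩
        sum (λ v → ((x v + x v) - (y v + y v)) - ((z v + z v) - (w v + w v)))
          ≡⟨ sum-sub (λ v → (x v + x v) - (y v + y v)) _ ⟩
        sum (λ v → (x v + x v) - (y v + y v)) - sum (λ v → (z v + z v) - (w v + w v))
          ≡⟨ cong₂ _-_ (trans (double-sub x y) (cong₂ _-_ (double xs) (double ys)))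
                       (trans (double-sub z w) (cong₂ _-_ (double zs) (double ws))) ⟩
        ((ι fixedVertices + ι fixedVertices) - (ι allVertices + ι allVertices))
          - ((1ℚ + 1ℚ) - (1ℚ + 1ℚ))
          -- The subtracted closed term evaluates to `0ℚ`.
          ≡⟨ +-identityʳ _ ⟩
        (ι fixedVertices + ι fixedVertices) - (ι allVertices + ι allVertices) ∎
        where
        x y z w : Fin n → ℚ
        x v = ι (𝟙 (P v) ℕ.* 𝟙 (does (v Fin.≟ g v)))
        y v = [ P v ]
        z v = δ v (g r) * [ P v ]
        w v = δ v r * [ P v ]
        double : ∀ {s t : ℚ} → s ≡ t → s + s ≡ t + t
        double refl = refl
        double-sub : ∀ (s t : Fin n → ℚ) →
                     sum (λ v → (s v + s v) - (t v + t v)) ≡ (sum s + sum s) - (sum t + sum t)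
        double-sub s t = trans (sum-sub (λ v → s v + s v) _)
                               (cong₂ _-_ (∑-distrib-+ s s) (∑-distrib-+ t t))
        xs : sum x ≡ ι fixedVertices
        xs = sym (ι-sum (λ v → 𝟙 (P v) ℕ.* 𝟙 (does (v Fin.≟ g v))))
        ys : sum y ≡ ι allVertices
        ys = sym (ι-sum (λ v → 𝟙 (P v)))
        zs : sum z ≡ 1ℚ
        zs = trans (sift (λ v → [ P v ]) (g r)) ([]-true (trans (P-g r) Pr))
        ws : sum w ≡ 1ℚ
        ws = trans (sift (λ v → [ P v ]) r) ([]-true Pr)
        atVertex : ∀ v b → P v ≡ b → [ b ] * (U v v - U v r) ≡ [ b ] * (Z v v - Z v r)
        atVertex v false _  = trans (*-zeroˡ (U v v - U v r)) (sym (*-zeroˡ (Z v v - Z v r)))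
        atVertex v true  Pv = cong (1ℚ *_) (U-Z v (connected Pr Pv))
        expand : ∀ v → [ P v ] * (Z v v - Z v r)
                       ≡ ((x v + x v) - (y v + y v)) - ((z v + z v) - (w v + w v))
        expand v = begin
          [ P v ] * (Z v v - Z v r)
            ≡⟨ cong (λ t → [ P v ] * (((δ v (g v) + δ v (g v)) - (t + t)) - Z v r)) (δ-refl v) ⟩
          [ P v ] * (((δ v (g v) + δ v (g v)) - (1ℚ + 1ℚ)) - Z v r)
            ≡⟨ solve 4 (λ P a b c →
                 (P :* (((a :+ a) :- (con 1ℚ :+ con 1ℚ)) :- ((b :+ b) :- (c :+ c))))
                 := ((((P :* a) :+ (P :* a)) :- (P :+ P))
                     :- (((b :* P) :+ (b :* P)) :- ((c :* P) :+ (c :* P))))) refl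
                 [ P v ] (δ v (g v)) (δ v (g r)) (δ v r) ⟩
          ((t + t) - (y v + y v)) - ((z v + z v) - (w v + w v))
            ≡⟨ cong (λ s → ((s + s) - (y v + y v)) - ((z v + z v) - (w v + w v)))
                    (ι-* (𝟙 (P v)) _) ⟨
          ((x v + x v) - (y v + y v)) - ((z v + z v) - (w v + w v)) ∎
          where t = [ P v ] * δ v (g v)

    -- The Lefschetz formula, doubled because edges are counted as ordered pairs, and with both
    -- sides moved so that no subtraction occurs.
    traceFormula : fixedEdges ℕ.+ (allVertices ℕ.+ allVertices)
                   ≡ allEdges ℕ.+ flippedEdges ℕ.+ (fixedVertices ℕ.+ fixedVertices)
    traceFormula = ι-injective (begin
      ι (fixedEdges ℕ.+ (allVertices ℕ.+ allVertices))
        ≡⟨ trans (ι-+ fixedEdges _) (cong (ι fixedEdges +_) (ι-+ allVertices allVertices)) ⟩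
      ι fixedEdges + (ι allVertices + ι allVertices)
        ≡⟨ solve 4 (λ a b c d → (a :+ d) := ((((a :- b) :- c) :+ d) :+ (c :+ b))) refl
                 (ι fixedEdges) (ι flippedEdges) (ι allEdges) (ι allVertices + ι allVertices) ⟩
      ι fixedEdges - ι flippedEdges - ι allEdges + (ι allVertices + ι allVertices)
        + (ι allEdges + ι flippedEdges)
        ≡⟨ cong (λ x → x + (ι allVertices + ι allVertices) + (ι allEdges + ι flippedEdges))
                (trans (sym L-edges) L-vertices) ⟩
      (ι fixedVertices + ι fixedVertices) - (ι allVertices + ι allVertices)
        + (ι allVertices + ι allVertices) + (ι allEdges + ι flippedEdges)
        ≡⟨ solve 3 (λ f v e → (((f :- v) :+ v) :+ e) := (e :+ f)) refl
                 (ι fixedVertices + ι fixedVertices) (ι allVertices + ι allVertices)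
                 (ι allEdges + ι flippedEdges) ⟩
      (ι allEdges + ι flippedEdges) + (ι fixedVertices + ι fixedVertices)
        ≡⟨ cong₂ _+_ (ι-+ allEdges flippedEdges) (ι-+ fixedVertices fixedVertices) ⟨
      ι (allEdges ℕ.+ flippedEdges) + ι (fixedVertices ℕ.+ fixedVertices)
        ≡⟨ ι-+ (allEdges ℕ.+ flippedEdges) _ ⟨
      ι (allEdges ℕ.+ flippedEdges ℕ.+ (fixedVertices ℕ.+ fixedVertices)) ∎)

inverse : ∀ {V E} → Auto V E → Auto V E
inverse {E = E} g = record
  { to = from g ; from = to g ; to-from = from-to g ; from-to = to-from g
  ; preserves = λ x y → trans (sym (preserves g (from g x) (from g y)))
                              (cong₂ E (to-from g x) (to-from g y)) }

-- Elements of the kernel fix the core pointwise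

module _ {n : ℕ} (Γ : SimpleGraph n) where
  open import Data.Nat using (_+_; _*_; z≤n; s≤s)
  open import Data.Nat.Properties
  open import Data.Nat.Tactic.RingSolver using (solve-∀)
  open ℕ∑ using (sum; sum-cong-≗; ∑-distrib-+; ∑-permute)

  -- Leaf removal is canonical: by induction on the round, `g` permutes the surviving vertices, and
  -- reindexing by it shows that degrees are preserved.
  removed-auto : (g : AutΓ Γ) → ∀ k v → removed Γ k (to g v) ≡ removed Γ k v
  removed-auto g zero    v = refl
  removed-auto g (suc k) v = cong₂ _∨_ (removed-auto g k v)
    (⇔→≡ {z = true} (mk⇔ (isLeafAt-cong Γ k k (removed-auto g k v) degree-auto)
                         (isLeafAt-cong Γ k k (sym (removed-auto g k v)) (sym degree-auto))))
    where
    π : Permutation′ n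
    π = permutation (to g) (from g) (to-from g) (from-to g)
    degree-auto : degAt Γ k (to g v) ≡ degAt Γ k v
    degree-auto = begin
      degAt Γ k (to g v)
        ≡⟨ count≡sum (λ w → alive Γ k w ∧ adj Γ (to g v) w) ⟩
      sum (λ w → 𝟙 (alive Γ k w ∧ adj Γ (to g v) w))
        ≡⟨ ∑-permute (λ w → 𝟙 (alive Γ k w ∧ adj Γ (to g v) w)) π ⟩
      sum (λ w → 𝟙 (alive Γ k (to g w) ∧ adj Γ (to g v) (to g w)))
        ≡⟨ sum-cong-≗ (λ w → cong₂ (λ r e → 𝟙 (not r ∧ e)) (removed-auto g k w) (preserves g v w)) ⟩
      sum (λ w → 𝟙 (alive Γ k w ∧ adj Γ v w))
        ≡⟨ count≡sum (λ w → alive Γ k w ∧ adj Γ v w) ⟨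
      degAt Γ k v ∎
      where open ≡-Reasoning

  adjAt-irrefl : ∀ k v → adjAt Γ k v v ≡ false
  adjAt-irrefl k v = ¬-not λ e → true≢false (proj₂ (proj₂ (adjAt⁻ Γ k e))) (adj-irrefl Γ v)

  edgeForm-isForm : ∀ p q → IsForm Γ (edgeForm p q)
  edgeForm-isForm p q x y _ = edgeForm-antisym p q x y

  module _ (conn : Connected Γ) (b : 2 ≤ betti1Connected Γ) (g : AutΓ Γ) (ker : InKer Γ g) where

    private
      -- The formula is applied to the core. The hypothesis on the kernel supplies potentials on all
      -- of Γ, used here on core edges; the base point is an end of some core edge.
      module T = Trace (alive Γ n) (adjAt Γ n) (adjAt-sym Γ n) (adjAt-irrefl n)
        (λ {v} {w} e → proj₁ (adjAt⁻ Γ n {v} {w} e)) (connectedAt Γ conn n)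
        (to g) (λ v → cong not (removed-auto g n v))
        (λ v w → cong₂ _∧_ (cong₂ (λ x y → not x ∧ not y) (removed-auto g n v) (removed-auto g n w))
                           (preserves g v w))
        (λ p q → proj₁ (ker (edgeForm p q) (edgeForm-isForm p q)))
        (λ p q {x} {y} e → proj₂ (ker (edgeForm p q) (edgeForm-isForm p q)) x y
                                 (proj₂ (proj₂ (adjAt⁻ Γ n {x} {y} e))))
        {proj₁ (edgeAt Γ conn b n)} (proj₁ (adjAt⁻ Γ n (proj₂ (proj₂ (edgeAt Γ conn b n)))))

      fix : Fin n → Bool
      fix v = does (v Fin.≟ to g v)

      fix⁻ : ∀ {v} → fix v ≡ true → to g v ≡ v
      fix⁻ {v} f with v Fin.≟ to g v
      ... | yes v≡gv = sym v≡gv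

      A : Fin n → Fin n → ℕ
      A v w = 𝟙 (adjAt Γ n v w)

      -- Respectively: ordered core edges from a fixed to a moved vertex, moved core vertices, and
      -- the sum of the core degrees of the moved vertices.
      cut moved movedDegree : ℕ
      cut         = sum₂ λ v w → A v w * (𝟙 (fix v) * 𝟙 (not (fix w)))
      moved       = sum λ v → 𝟙 (alive Γ n v) * 𝟙 (not (fix v))
      movedDegree = sum₂ λ v w → 𝟙 (not (fix v)) * A v w

      allEdges≡ : T.allEdges ≡ T.fixedEdges + (cut + movedDegree)
      allEdges≡ = begin
        T.allEdges
          ≡⟨ sum₂-cong (λ v w → split (adjAt Γ n v w) (fix v) (fix w)) ⟩
        sum₂ (λ v w → A v w * (𝟙 (fix v) * 𝟙 (fix w))
                      + (A v w * (𝟙 (fix v) * 𝟙 (not (fix w))) + 𝟙 (not (fix v)) * A v w))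
          ≡⟨ sum₂-+ (λ v w → A v w * (𝟙 (fix v) * 𝟙 (fix w))) _ ⟩
        T.fixedEdges + sum₂ (λ v w → A v w * (𝟙 (fix v) * 𝟙 (not (fix w))) + 𝟙 (not (fix v)) * A v w)
          ≡⟨ cong (T.fixedEdges +_) (sum₂-+ (λ v w → A v w * (𝟙 (fix v) * 𝟙 (not (fix w)))) _) ⟩
        T.fixedEdges + (cut + movedDegree) ∎
        where
        open ≡-Reasoning
        split : ∀ a f h → 𝟙 a ≡ 𝟙 a * (𝟙 f * 𝟙 h) + (𝟙 a * (𝟙 f * 𝟙 (not h)) + 𝟙 (not f) * 𝟙 a)
        split false false h     = refl
        split false true  h     = refl
        split true  false h     = refl
        split true  true  false = refl
        split true  true  true  = refl

      allVertices≡ : T.allVertices ≡ T.fixedVertices + moved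
      allVertices≡ = trans (sum-cong-≗ (λ v → split (alive Γ n v) (fix v)))
                           (∑-distrib-+ (λ v → 𝟙 (alive Γ n v) * 𝟙 (fix v)) _)
        where
        split : ∀ a f → 𝟙 a ≡ 𝟙 a * 𝟙 f + 𝟙 a * 𝟙 (not f)
        split false f     = refl
        split true  false = refl
        split true  true  = refl

      moved≤ : moved + moved ≤ movedDegree
      moved≤ = begin
        moved + moved                              ≡⟨ ∑-distrib-+ m m ⟨
        sum (λ v → m v + m v)                      ≤⟨ sum-mono bound ⟩
        movedDegree                                ∎
        where
        open ≤-Reasoning
        m : Fin n → ℕ
        m v = 𝟙 (alive Γ n v) * 𝟙 (not (fix v))
        bound : ∀ v → m v + m v ≤ sum (λ w → 𝟙 (not (fix v)) * A v w)
        bound v with fix v | alive Γ n v ≟ᵇ true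
        ... | true  | _ = ≤-trans (≤-reflexive (cong (λ x → x + x) (*-zeroʳ (𝟙 (alive Γ n v))))) z≤n
        ... | false | no ¬a = ≤-trans (≤-reflexive (cong (λ a → 𝟙 a * 1 + 𝟙 a * 1) (¬-not ¬a))) z≤n
        ... | false | yes a = begin
          𝟙 (alive Γ n v) * 1 + 𝟙 (alive Γ n v) * 1  ≡⟨ cong (λ a → 𝟙 a * 1 + 𝟙 a * 1) a ⟩
          2                                          ≤⟨ coreDegree Γ conn b a ⟩
          sum (A v)                                  ≡⟨ sum-cong-≗ (λ w → +-identityʳ (A v w)) ⟨
          sum (λ w → 1 * A v w)                      ∎

      -- Inserting `allEdges≡` and `allVertices≡`, the trace formula becomes `cut + movedDegree +
      -- flippedEdges = moved + moved`, while `moved≤` bounds the right side by `movedDegree`.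
      cut≡0 : cut ≡ 0
      cut≡0 = n≤0⇒n≡0 (+-cancelʳ-≤ (rest + (moved + moved)) cut 0 (begin
        cut + (rest + (moved + moved))    ≤⟨ +-monoʳ-≤ cut (+-monoʳ-≤ rest moved≤) ⟩
        cut + (rest + movedDegree)
          ≡⟨ gather T.fixedEdges T.flippedEdges T.fixedVertices cut movedDegree ⟩
        T.fixedEdges + (cut + movedDegree) + T.flippedEdges + (T.fixedVertices + T.fixedVertices)
          ≡⟨ cong (λ e → e + T.flippedEdges + (T.fixedVertices + T.fixedVertices)) allEdges≡ ⟨
        T.allEdges + T.flippedEdges + (T.fixedVertices + T.fixedVertices)
          ≡⟨ T.traceFormula ⟨
        T.fixedEdges + (T.allVertices + T.allVertices)
          ≡⟨ cong (λ v → T.fixedEdges + (v + v)) allVertices≡ ⟩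
        T.fixedEdges + (T.fixedVertices + moved + (T.fixedVertices + moved))
          -- Flipped edges are added so that the same summand `rest` stands on both sides and
          -- cancels.
          ≤⟨ m≤n+m _ T.flippedEdges ⟩
        T.flippedEdges + (T.fixedEdges + (T.fixedVertices + moved + (T.fixedVertices + moved)))
          ≡⟨ gather′ T.fixedEdges T.flippedEdges T.fixedVertices moved ⟩
        rest + (moved + moved) ∎))
        where
        open ≤-Reasoning
        rest : ℕ
        rest = T.flippedEdges + T.fixedEdges + (T.fixedVertices + T.fixedVertices)
        gather : ∀ fe fl fv c d → c + (fl + fe + (fv + fv) + d) ≡ fe + (c + d) + fl + (fv + fv)
        gather = solve-∀
        gather′ : ∀ fe fl fv m → fl + (fe + (fv + m + (fv + m))) ≡ fl + fe + (fv + fv) + (m + m)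
        gather′ = solve-∀

      -- By the trace formula fixed edges together with twice the vertices are at least all edges,
      -- and by `excess` these outnumber twice the vertices. This is where the bound on the Betti
      -- number starts the argument off.
      fixedEdgeExists : 1 ≤ T.fixedEdges
      fixedEdgeExists = +-cancelʳ-≤ (T.allVertices + T.allVertices) 1 T.fixedEdges (begin
        1 + (T.allVertices + T.allVertices)   ≤⟨ n≤1+n _ ⟩
        2 + (T.allVertices + T.allVertices)   ≡⟨ +-comm 2 (T.allVertices + T.allVertices) ⟩
        T.allVertices + T.allVertices + 2     ≤⟨ excess Γ b n ⟩
        T.allEdges                            ≤⟨ m≤m+n _ T.flippedEdges ⟩
        T.allEdges + T.flippedEdges           ≤⟨ m≤m+n _ _ ⟩
        T.allEdges + T.flippedEdges + (T.fixedVertices + T.fixedVertices)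
                                              ≡⟨ T.traceFormula ⟨
        T.fixedEdges + (T.allVertices + T.allVertices) ∎)
        where open ≤-Reasoning

      fixedNeighbour : ∀ {v w} → adjAt Γ n v w ≡ true → fix v ≡ true → fix w ≡ true
      fixedNeighbour {v} {w} e f with fix w in f′
      ... | true  = refl
      ... | false = contradiction (begin
        1                                      ≡⟨ cong₂ (λ x y → 𝟙 x * (𝟙 y * 1)) e f ⟨
        A v w * (𝟙 (fix v) * 1)                ≡⟨ cong (λ x → A v w * (𝟙 (fix v) * 𝟙 (not x))) f′ ⟨
        A v w * (𝟙 (fix v) * 𝟙 (not (fix w)))
          ≤⟨ term≤sum₂ (λ v w → A v w * (𝟙 (fix v) * 𝟙 (not (fix w)))) v w ⟩
        cut                                    ≡⟨ cut≡0 ⟩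
        0                                      ∎) λ ()
        where open ≤-Reasoning

      fixedAlong : ∀ {v w} → Walk Γ n v w → fix v ≡ true → fix w ≡ true
      fixedAlong ε        f = f
      fixedAlong (e ◅ es) f = fixedAlong es (fixedNeighbour e f)

    -- Since `cut` is zero, being fixed spreads along walks in the core, starting from an end of a
    -- fixed edge.
    kernelFixesCore : ∀ {v} → alive Γ n v ≡ true → to g v ≡ v
    kernelFixesCore av with sum₂-positive _ fixedEdgeExists
    ... | x , y , 1≤ = fix⁻ (fixedAlong (connectedAt Γ conn n (proj₁ (adjAt⁻ Γ n ex)) av) fx)
      where
      factors : ∀ a f h → 1 ≤ 𝟙 a * (𝟙 f * 𝟙 h) → a ≡ true × f ≡ true
      factors true true h _ = refl , refl
      ex = proj₁ (factors (adjAt Γ n x y) (fix x) (fix y) 1≤)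
      fx = proj₂ (factors (adjAt Γ n x y) (fix x) (fix y) 1≤)

-- Automorphisms fixing the core act trivially on cohomology

module _ {n : ℕ} (Γ : SimpleGraph n) (conn : Connected Γ) (b : 2 ≤ betti1Connected Γ) where
  open import Data.Rational using (ℚ; _-_; -_; 0ℚ)
  open import Data.Rational.Properties using (+-inverseʳ)
  open import Data.Rational.Solver using (module +-*-Solver)
  open +-*-Solver using (solve; _:=_; _:-_; :-_)

  ExactAt : ℕ → (Fin n → Fin n → ℚ) → Set
  ExactAt k h = ∃ λ (u : Fin n → ℚ) → ∀ v w → adjAt Γ k v w ≡ true → h v w ≡ u w - u v

  -- The single edge at a leaf dictates the value there. Its other end is not a leaf of the same
  -- round, so that end keeps its old value and the choices do not interfere.
  extendPotential : ∀ {h} → IsForm Γ h → ∀ k → ExactAt (suc k) h → ExactAt k h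
  extendPotential {h} form k (u , du) = u′ , exact
    where
    value : ∀ v → ∃ λ x →
            (isLeafAt Γ k v ≡ true → ∀ w → adjAt Γ k v w ≡ true → h v w ≡ u w - x) ×
            (isLeafAt Γ k v ≢ true → x ≡ u v)
    value v with isLeafAt Γ k v ≟ᵇ true
    ... | no ¬l = u v , (λ l → contradiction l ¬l) , (λ _ → refl)
    ... | yes l with neighbourAt Γ conn b k (not-false (proj₁ (leaf⁻ Γ k v l)))
    -- The solution `x` of `h v p ≡ u p - x`, where `p` is the only neighbour of the leaf.
    ...   | p , ep = u p - h v p , atLeaf , (λ ¬l → contradiction l ¬l)
      where
      atLeaf : isLeafAt Γ k v ≡ true → ∀ w → adjAt Γ k v w ≡ true → h v w ≡ u w - (u p - h v p)
      atLeaf _ w ew with leafNeighbour-unique Γ k l ew ep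
      ... | refl = solve 2 (λ s t → t := (s :- (s :- t))) refl (u p) (h v p)
    u′ : Fin n → ℚ
    u′ v = proj₁ (value v)
    exact : ∀ v w → adjAt Γ k v w ≡ true → h v w ≡ u′ w - u′ v
    exact v w e = byLeaves (isLeafAt Γ k v ≟ᵇ true) (isLeafAt Γ k w ≟ᵇ true)
      where
      open ≡-Reasoning
      av = proj₁ (adjAt⁻ Γ k e)
      aw = proj₁ (proj₂ (adjAt⁻ Γ k e))
      e′ = proj₂ (proj₂ (adjAt⁻ Γ k e))
      byLeaves : Dec (isLeafAt Γ k v ≡ true) → Dec (isLeafAt Γ k w ≡ true) → h v w ≡ u′ w - u′ v
      -- The survivor required by `leavesNotAdjacent` is an end of an edge of the next stage.
      byLeaves (yes lv) (yes lw) = ⊥-elim (leavesNotAdjacent Γ conn k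
            (proj₁ (adjAt⁻ Γ (suc k) (proj₂ (proj₂ (edgeAt Γ conn b (suc k)))))) e lv lw)
      byLeaves (yes lv) (no ¬lw) = trans (proj₁ (proj₂ (value v)) lv w e)
            (cong (λ x → x - u′ v) (sym (proj₂ (proj₂ (value w)) ¬lw)))
      byLeaves (no ¬lv) (yes lw) = begin
            h v w              ≡⟨ form v w (proj₂ (proj₂ (adjAt⁻ Γ k e))) ⟩
            - h w v
              ≡⟨ cong -_ (proj₁ (proj₂ (value w)) lw v (trans (adjAt-sym Γ k w v) e)) ⟩
            - (u v - u′ w)     ≡⟨ solve 2 (λ s t → (:- (s :- t)) := (t :- s)) refl (u v) (u′ w) ⟩
            u′ w - u v         ≡⟨ cong (λ x → u′ w - x) (proj₂ (proj₂ (value v)) ¬lv) ⟨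
            u′ w - u′ v        ∎
      byLeaves (no ¬lv) (no ¬lw) = trans
            (du v w (adjAt⁺ Γ (suc k) (alive-suc Γ k av (¬-not ¬lv)) (alive-suc Γ k aw (¬-not ¬lw)) e′))
            (sym (cong₂ _-_ (proj₂ (proj₂ (value w)) ¬lw) (proj₂ (proj₂ (value v)) ¬lv)))

  exactFromStage : ∀ {h} → IsForm Γ h → ∀ k → ExactAt k h → IsExact Γ h
  exactFromStage form zero    x = x
  exactFromStage form (suc k) x = exactFromStage form k (extendPotential form k x)

  fixesCore⇒kernel : (g : AutΓ Γ) → (∀ {v} → alive Γ n v ≡ true → to g v ≡ v) → InKer Γ g
  fixesCore⇒kernel g fixes f form = exactFromStage form′ n ((λ _ → 0ℚ) , zeroOnCore)
    where
    form′ : IsForm Γ (λ v w → f (to g v) (to g w) - f v w)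
    form′ v w e = trans
      (cong₂ _-_ (form (to g v) (to g w) (trans (preserves g v w) e)) (form v w e))
      (solve 2 (λ s t → ((:- s) :- (:- t)) := (:- (s :- t))) refl (f (to g w) (to g v)) (f w v))
    zeroOnCore : ∀ v w → adjAt Γ n v w ≡ true → f (to g v) (to g w) - f v w ≡ 0ℚ - 0ℚ
    zeroOnCore v w e = trans
      (cong (λ x → x - f v w) (cong₂ f (fixes (proj₁ (adjAt⁻ Γ n e))) (fixes (proj₁ (proj₂ (adjAt⁻ Γ n e))))))
      (+-inverseʳ (f v w))

-- Restriction to F(Γ) and extension from F(Γ)

any-tabulate⁺ : ∀ {m} {A : Set} (p : A → Bool) (h : Fin m → A) i →
                p (h i) ≡ true → any p (tabulate h) ≡ true
any-tabulate⁺ p h zero    e = cong (_∨ any p (tabulate (h ∘ suc))) e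
any-tabulate⁺ p h (suc i) e =
  trans (cong (p (h zero) ∨_) (any-tabulate⁺ p (h ∘ suc) i e)) (∨-zeroʳ (p (h zero)))

any-tabulate⁻ : ∀ {m} {A : Set} (p : A → Bool) (h : Fin m → A) →
                any p (tabulate h) ≡ true → ∃ λ i → p (h i) ≡ true
any-tabulate⁻ {suc m} p h e with p (h zero) in eq
... | true  = zero , eq
... | false = let i , ei = any-tabulate⁻ p (h ∘ suc) e in suc i , ei

module _ {n : ℕ} (Γ : SimpleGraph n) where

  inFV-core : ∀ {v} → inForestCore Γ v ≡ true → inFV Γ v ≡ true
  inFV-core r rewrite r = refl

  inFV-neighbour : ∀ {v} w → inForestCore Γ w ≡ true → adj Γ v w ≡ true → inFV Γ v ≡ true
  inFV-neighbour {v} w r e = trans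
    (cong (inForestCore Γ v ∨_)
          (any-tabulate⁺ (λ w → inForestCore Γ w ∧ adj Γ v w) id w (r ∧-intro e)))
    (∨-zeroʳ (inForestCore Γ v))

  inFV⁻ : ∀ {v} → inFV Γ v ≡ true →
          inForestCore Γ v ≡ true ⊎ ∃ λ w → inForestCore Γ w ≡ true × adj Γ v w ≡ true
  inFV⁻ {v} p with inForestCore Γ v
  ... | true  = inj₁ refl
  ... | false with any-tabulate⁻ (λ w → inForestCore Γ w ∧ adj Γ v w) id p
  ...   | w , e = inj₂ (w , ∧-conicalˡ _ _ e , ∧-conicalʳ (inForestCore Γ w) _ e)

  inFV-auto : (g : AutΓ Γ) → ∀ {v} → inFV Γ v ≡ true → inFV Γ (to g v) ≡ true
  inFV-auto g {v} p with inFV⁻ p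
  ... | inj₁ r           = inFV-core (trans (removed-auto Γ g n v) r)
  ... | inj₂ (w , r , e) = inFV-neighbour (to g w) (trans (removed-auto Γ g n w) r)
                                          (trans (preserves g v w) e)

  -- Membership in F(Γ) is a Boolean equation, whose proofs are unique.
  FVert-≡ : {x y : FVert Γ} → proj₁ x ≡ proj₁ y → x ≡ y
  FVert-≡ {v , p} {.v , q} refl = cong (v ,_) (uip p q)

  restrict : AutΓ Γ → AutF Γ
  restrict g = record
    { to        = λ (v , p) → to g v , inFV-auto g p
    ; from      = λ (v , p) → from g v , inFV-auto (inverse g) p
    ; to-from   = λ (v , p) → FVert-≡ (to-from g v)
    ; from-to   = λ (v , p) → FVert-≡ (from-to g v)
    ; preserves = λ (v , _) (w , _) →
        cong₂ _∧_ (preserves g v w) (cong₂ _∨_ (removed-auto Γ g n v) (removed-auto Γ g n w))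
    }

  -- Defined for bare maps, so that it applies alike to an automorphism and to its inverse.
  extend : (FVert Γ → FVert Γ) → Fin n → Fin n
  extend h v with inFV Γ v ≟ᵇ true
  ... | yes p = proj₁ (h (v , p))
  ... | no  _ = v

  extend-F : ∀ h (x : FVert Γ) → extend h (proj₁ x) ≡ proj₁ (h x)
  extend-F h (v , p) with inFV Γ v ≟ᵇ true
  ... | yes q = cong (λ p → proj₁ (h (v , p))) (uip q p)
  ... | no ¬p = contradiction p ¬p

  extend-outside : ∀ h {v} → inFV Γ v ≢ true → extend h v ≡ v
  extend-outside h {v} ¬p with inFV Γ v ≟ᵇ true
  ... | yes p = contradiction p ¬p
  ... | no  _ = refl

  extend-inverse : ∀ {h h′} → (∀ x → h (h′ x) ≡ x) → ∀ v → extend h (extend h′ v) ≡ v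
  extend-inverse {h} {h′} hh′ v with inFV Γ v ≟ᵇ true
  ... | yes p = trans (extend-F h (h′ (v , p))) (cong proj₁ (hh′ (v , p)))
  ... | no ¬p = extend-outside h ¬p

  module _ (s : AutF Γ) (fixes : InS Γ s) where

    -- A core vertex in F(Γ) is an intersection vertex, fixed by hypothesis; any other core vertex
    -- lies outside F(Γ).
    extend-fixesCore : ∀ {v} → alive Γ n v ≡ true → extend (to s) v ≡ v
    extend-fixesCore {v} a with inFV Γ v ≟ᵇ true
    ... | yes p = fixes (v , p) (p ∧-intro a)
    ... | no  _ = refl

    -- If s x left the forest core it would be an intersection vertex, hence fixed, so s x = x.
    preservesForest : ∀ x → inForestCore Γ (proj₁ x) ≡ true → inForestCore Γ (proj₁ (to s x)) ≡ true
    preservesForest x r with inForestCore Γ (proj₁ (to s x)) ≟ᵇ true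
    ... | yes r′ = r′
    ... | no ¬r′ = contradiction (trans (cong (λ y → inForestCore Γ (proj₁ y)) sx≡x) r) ¬r′
      where
      ssx≡sx : to s (to s x) ≡ to s x
      ssx≡sx = FVert-≡ (fixes (to s x) (proj₂ (to s x) ∧-intro not-false (¬-not ¬r′)))
      sx≡x : to s x ≡ x
      sx≡x = trans (sym (from-to s (to s x))) (trans (cong (from s) ssx≡sx) (from-to s x))

    private
      -- Every edge at a removed vertex belongs to F(Γ), so there `FAdj` agrees with `adj`, and `s`
      -- preserves it and sends `v` to a removed vertex.
      extend-adjForest : ∀ v w → inForestCore Γ v ≡ true →
                         adj Γ (extend (to s) v) (extend (to s) w) ≡ adj Γ v w
      extend-adjForest v w r with inFV Γ w ≟ᵇ true
      ... | yes q = begin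
        adj Γ (extend (to s) v) (proj₁ (to s y)) ≡⟨ cong (λ z → adj Γ z (proj₁ (to s y))) (extend-F (to s) x) ⟩
        adj Γ (proj₁ (to s x)) (proj₁ (to s y))  ≡⟨ forestEdge (to s x) (to s y) (preservesForest x r) ⟨
        FAdj Γ (to s x) (to s y)                 ≡⟨ preserves s x y ⟩
        FAdj Γ x y                               ≡⟨ forestEdge x y r ⟩
        adj Γ v w                                ∎
        where
        open ≡-Reasoning
        x y : FVert Γ
        x = v , inFV-core r
        y = w , q
        forestEdge : ∀ x y → inForestCore Γ (proj₁ x) ≡ true →
                     FAdj Γ x y ≡ adj Γ (proj₁ x) (proj₁ y)
        forestEdge (v , _) (w , _) r =
          trans (cong (λ c → adj Γ v w ∧ (c ∨ inForestCore Γ w)) r) (∧-identityʳ (adj Γ v w))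
      -- Here `w` stays in place and has no removed neighbour, while `v` and its image are both
      -- removed vertices.
      ... | no ¬q = trans (notAdjacent (extend (to s) v) r′) (sym (notAdjacent v r))
        where
        r′ : inForestCore Γ (extend (to s) v) ≡ true
        r′ = trans (cong (inForestCore Γ) (extend-F (to s) (v , inFV-core r)))
                   (preservesForest (v , inFV-core r) r)
        notAdjacent : ∀ x → inForestCore Γ x ≡ true → adj Γ x w ≡ false
        notAdjacent x rx = ¬-not λ e → ¬q (inFV-neighbour x rx (trans (adj-sym Γ w x) e))

    extend-adj : ∀ v w → adj Γ (extend (to s) v) (extend (to s) w) ≡ adj Γ v w
    extend-adj v w with inForestCore Γ v ≟ᵇ true | inForestCore Γ w ≟ᵇ true
    ... | yes r | _     = extend-adjForest v w r
    ... | no _  | yes r = trans (adj-sym Γ _ _) (trans (extend-adjForest w v r) (adj-sym Γ w v))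
    ... | no ¬r | no ¬r′ = cong₂ (adj Γ) (extend-fixesCore (not-false (¬-not ¬r)))
                                         (extend-fixesCore (not-false (¬-not ¬r′)))

    extendAuto : AutΓ Γ
    extendAuto = record
      { to = extend (to s) ; from = extend (from s)
      ; to-from = extend-inverse (to-from s) ; from-to = extend-inverse (from-to s)
      ; preserves = extend-adj }

-- The isomorphism between the kernel and S

theorem3p14 : ∀ {n : ℕ} (Γ : SimpleGraph n) → Connected Γ → 2 ≤ betti1Connected Γ → KerIsoS Γ
theorem3p14 {n} Γ conn b = record
  { φ      = λ g _ → restrict Γ g
  ; φ-S    = λ g k x i → kernelFixesCore Γ conn b g k (∧-conicalʳ (inFV Γ (proj₁ x)) _ i)
  ; ψ      = extendAuto Γ
  ; ψ-ker  = λ s p → fixesCore⇒kernel Γ conn b (extendAuto Γ s p) (extend-fixesCore Γ s p)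
  ; φ-resp = λ _ _ _ _ g≈g′ (v , _) → FVert-≡ Γ (g≈g′ v)
  ; ψ-resp = λ s s′ _ _ s≈s′ v → extend-resp s s′ s≈s′ v
  ; φ-hom  = λ _ _ _ _ _ _ → FVert-≡ Γ refl
  ; ψφ     = λ g k v → extend-restrict g k v
  ; φψ     = λ s p x → FVert-≡ Γ (extend-F Γ (to s) x)
  }
  where
  extend-resp : ∀ (s s′ : AutF Γ) → s ≈ᴬ s′ → ∀ v → extend Γ (to s) v ≡ extend Γ (to s′) v
  extend-resp s s′ s≈s′ v with inFV Γ v ≟ᵇ true
  ... | yes p = cong proj₁ (s≈s′ (v , p))
  ... | no  _ = refl
  extend-restrict : ∀ g → InKer Γ g → ∀ v → extend Γ (to (restrict Γ g)) v ≡ to g v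
  extend-restrict g k v with inFV Γ v ≟ᵇ true
  ... | yes _ = refl
  -- All removed vertices lie in F(Γ), so a vertex outside F(Γ) is in the core.
  ... | no ¬p = sym (kernelFixesCore Γ conn b g k (not-false (¬-not (¬p ∘ inFV-core Γ))))
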